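{- Let $\mathcal{F}$ be a frequency hopping scheme of length $n$ consisting of a single word, and let $\mathcal{D}$ be the corresponding partition type disjoint difference family over $\mathbb{Z}_n$. Let $\gamma\in N_{S_n}(\langle\rho_n\rangle)$. Then the frequency hopping scheme obtained by applying the permutation $\gamma$ to the coordinate positions of $\mathcal{F}$ corresponds to a disjoint difference family that is a translation of the disjoint difference family obtained from $\mathcal{D}$ by applying the automorphism $\phi_\gamma$ to the elements of $\mathbb{Z}_n$.
   Context: An $(n,M,q)$-frequency hopping scheme (FHS) is a set of $M$ words of length $n$ over an alphabet of size $q$. Permutations act on the right and are composed from left to right. A permutation $\gamma\in S_n$ acts on a word $\mathbf{w}$ of length $n$ (coordinate positions $1,\ldots,n$) by permuting coordinate positions: the entry in position $i$ of $\mathbf{w}$ becomes the entry in position $i^\gamma$ of $\mathbf{w}^\gamma$. Let $\rho_n=(1\;2\;\cdots\;n)\in S_n$, and let $N_{S_n}(\langle\rho_n\rangle)$ be the normaliser of $\langle\rho_n\rangle$ in $S_n$. For $\gamma\in N_{S_n}(\langle\rho_n\rangle)$, the map $\phi_\gamma:\mathbb{Z}_n\to\mathbb{Z}_n$ sends $i$ to the unique $j\in\mathbb{Z}_n$ with $\gamma^{ -1}\rho_n^i\gamma=\rho_n^j$; it is an automorphism of $\mathbb{Z}_n$. A partition type disjoint difference family over $\mathbb{Z}_n$ is a family $(\mathbb{Z}_n;Q_0,\ldots,Q_{q-1})$ of disjoint subsets of $\mathbb{Z}_n$ that partition $\mathbb{Z}_n$. The one corresponding to a single word $\mathbf{w}$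 of length $n$ has one subset for each alphabet symbol $f$, namely the set of $j\in\mathbb{Z}_n=\{0,\ldots,n-1\}$ such that the entry of $\mathbf{w}$ in position $j+1$ equals $f$. Applying an automorphism $\phi$ of $\mathbb{Z}_n$ to the family replaces each $Q_i$ by $\phi(Q_i)$; a translation of the family replaces each $Q_i$ by $Q_i+c$ for one fixed $c\in\mathbb{Z}_n$. -}

module Defs where

open import Algebra.Bundles using (Group; AbelianGroup)
open import Algebra.Morphism.Structures using (module GroupMorphisms)
import Algebra.Definitions.RawMonoid as RawMonoidPower
import Algebra.Properties.AbelianGroup as AbelianGroupProperties
open import Data.Fin.Base using (Fin; zero; toℕ)
open import Data.Fin.Permutation as Perm using (Permutation′; permutation; _⟨$⟩ʳ_; _⟨$⟩ˡ_; _∘ₚ_)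
open import Data.Fin.Properties using (toℕ-injective; toℕ-fromℕ<; toℕ<n)
open import Data.Integer.Base using (ℤ; +_; -[1+_])
open import Data.Nat.Base as ℕ using (ℕ; suc; NonZero)
open import Data.Nat.DivMod using (_%_; _mod_; m%n<n; m%n%n≡m%n; m<n⇒m%n≡m; %-distribˡ-+; n%n≡0)
import Data.Nat.Properties as ℕₚ
open import Data.Product using (∃; ∃!; _×_; _,_; proj₁; proj₂)
open import Data.Vec.Base using (Vec; lookup; tabulate)
open import Data.Vec.Properties using (lookup∘tabulate; tabulate∘lookup; tabulate-cong)
open import Function.Definitions using (Injective; Surjective; Bijective)
open import Level using (Level; 0ℓ; _⊔_)
open import Relation.Binary.PropositionalEquality
open import Relation.Unary using (Pred; _∈_; _≐_; _⊥_)

module _ {a ℓ : Level} (G : Group a ℓ) where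
  open Group G
  open RawMonoidPower rawMonoid using () renaming (_×_ to _times_)

  power : Carrier → ℤ → Carrier
  power g (+ k)    = k times g
  power g -[1+ k ] = (suc k times g) ⁻¹

  Generated : Carrier → Pred Carrier ℓ
  Generated g x = ∃ λ (k : ℤ) → x ≈ power g k

  conjugate : Carrier → Carrier → Carrier
  conjugate γ h = (γ ⁻¹ ∙ h) ∙ γ

  Conjugate : ∀ {p} → Carrier → Pred Carrier p → Pred Carrier (a ⊔ ℓ ⊔ p)
  Conjugate γ H x = ∃ λ h → h ∈ H × x ≈ conjugate γ h

  Normaliser : ∀ {p} → Pred Carrier p → Pred Carrier (a ⊔ ℓ ⊔ p)
  Normaliser H γ = Conjugate γ H ≐ H

  record Automorphism : Set (a ⊔ ℓ) where
    open GroupMorphisms rawGroup rawGroup using (IsGroupIsomorphism)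
    field
      ⟦_⟧                : Carrier → Carrier
      isGroupIsomorphism : IsGroupIsomorphism ⟦_⟧

    open IsGroupIsomorphism isGroupIsomorphism public
      using (injective; surjective)

-- The product _∘ₚ_ applies its left factor first, and _⟨$⟩ʳ_ is the
-- action on points: i^γ is γ ⟨$⟩ʳ i.
Sym : ℕ → Group 0ℓ 0ℓ
Sym n = record
  { Carrier = Permutation′ n
  ; _≈_     = Perm._≈_
  ; _∙_     = _∘ₚ_
  ; ε       = Perm.id
  ; _⁻¹     = Perm.flip
  ; isGroup = record
    { isMonoid = record
      { isSemigroup = record
        { isMagma = record
          { isEquivalence = record
            { refl  = λ _ → refl
            ; sym   = λ p i → sym (p i)
            ; trans = λ p q i → trans (p i) (q i)
            }
          ; ∙-cong = λ {_} {_} {π} p q i →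
              trans (cong (π ⟨$⟩ʳ_) (p i)) (q _)
          }
        ; assoc = λ _ _ _ _ → refl
        }
      ; identity = (λ _ _ → refl) , (λ _ _ → refl)
      }
    ; inverse = (λ π _ → Perm.inverseʳ π) , (λ π _ → Perm.inverseˡ π)
    ; ⁻¹-cong = λ {π} {σ} p i → trans
        (cong (π ⟨$⟩ˡ_) (trans (sym (Perm.inverseʳ σ)) (sym (p _))))
        (Perm.inverseˡ π)
    }
  }

module _ (n : ℕ) .{{_ : NonZero n}} where

  private
    _⊕_ : Fin n → Fin n → Fin n
    i ⊕ j = (toℕ i ℕ.+ toℕ j) mod n

    𝟘 : Fin n
    𝟘 = 0 mod n

    ⊖_ : Fin n → Fin n
    ⊖ i = (n ℕ.∸ toℕ i) mod n

    toℕ-mod : ∀ m → toℕ (m mod n) ≡ m % n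
    toℕ-mod m = toℕ-fromℕ< (m%n<n m n)

    mod-cong : ∀ {k m} → k % n ≡ m % n → k mod n ≡ m mod n
    mod-cong p = toℕ-injective (trans (toℕ-mod _) (trans p (sym (toℕ-mod _))))

    mod-toℕ : ∀ i → toℕ i mod n ≡ i
    mod-toℕ i = toℕ-injective (trans (toℕ-mod _) (m<n⇒m%n≡m (toℕ<n i)))

    mod-+ : ∀ k m → (k ℕ.+ m) mod n ≡ (k mod n) ⊕ (m mod n)
    mod-+ k m = mod-cong (trans (%-distribˡ-+ k m n)
      (cong (_% n) (sym (cong₂ ℕ._+_ (toℕ-mod k) (toℕ-mod m)))))

    ⊕-comm : ∀ i j → i ⊕ j ≡ j ⊕ i
    ⊕-comm i j = cong (_mod n) (ℕₚ.+-comm (toℕ i) (toℕ j))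

    ⊕-assoc : ∀ i j k → (i ⊕ j) ⊕ k ≡ i ⊕ (j ⊕ k)
    ⊕-assoc i j k = begin
      (i ⊕ j) ⊕ k                             ≡⟨ cong ((i ⊕ j) ⊕_) (mod-toℕ k) ⟨
      (i ⊕ j) ⊕ (toℕ k mod n)                 ≡⟨ mod-+ (toℕ i ℕ.+ toℕ j) (toℕ k) ⟨
      (toℕ i ℕ.+ toℕ j ℕ.+ toℕ k) mod n       ≡⟨ cong (_mod n) (ℕₚ.+-assoc (toℕ i) (toℕ j) (toℕ k)) ⟩
      (toℕ i ℕ.+ (toℕ j ℕ.+ toℕ k)) mod n     ≡⟨ mod-+ (toℕ i) (toℕ j ℕ.+ toℕ k) ⟩
      (toℕ i mod n) ⊕ (j ⊕ k)                 ≡⟨ cong (_⊕ (j ⊕ k)) (mod-toℕ i) ⟩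
      i ⊕ (j ⊕ k)                             ∎
      where open ≡-Reasoning

    ⊕-identityˡ : ∀ i → 𝟘 ⊕ i ≡ i
    ⊕-identityˡ i = begin
      𝟘 ⊕ i               ≡⟨ cong (𝟘 ⊕_) (mod-toℕ i) ⟨
      𝟘 ⊕ (toℕ i mod n)   ≡⟨ mod-+ 0 (toℕ i) ⟨
      toℕ i mod n         ≡⟨ mod-toℕ i ⟩
      i                   ∎
      where open ≡-Reasoning

    ⊕-inverseʳ : ∀ i → i ⊕ (⊖ i) ≡ 𝟘
    ⊕-inverseʳ i = begin
      i ⊕ (⊖ i)                           ≡⟨ cong (_⊕ (⊖ i)) (mod-toℕ i) ⟨
      (toℕ i mod n) ⊕ (⊖ i)               ≡⟨ mod-+ (toℕ i) (n ℕ.∸ toℕ i) ⟨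
      (toℕ i ℕ.+ (n ℕ.∸ toℕ i)) mod n     ≡⟨ cong (_mod n) (ℕₚ.m+[n∸m]≡n (ℕₚ.<⇒≤ (toℕ<n i))) ⟩
      n mod n                             ≡⟨ mod-cong (trans (n%n≡0 n) (sym (m<n⇒m%n≡m (ℕ.>-nonZero⁻¹ n)))) ⟩
      𝟘                                   ∎
      where open ≡-Reasoning

  ℤmod : AbelianGroup 0ℓ 0ℓ
  ℤmod = record
    { Carrier = Fin n
    ; _≈_     = _≡_
    ; _∙_     = _⊕_
    ; ε       = 𝟘
    ; _⁻¹     = ⊖_
    ; isAbelianGroup = record
      { isGroup = record
        { isMonoid = record
          { isSemigroup = record
            { isMagma = isMagma _⊕_
            ; assoc   = ⊕-assoc
            }
          ; identity = ⊕-identityˡ , λ i → trans (⊕-comm i 𝟘) (⊕-identityˡ i)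
          }
        ; inverse = (λ i → trans (⊕-comm (⊖ i) i) (⊕-inverseʳ i)) , ⊕-inverseʳ
        ; ⁻¹-cong = cong ⊖_
        }
      ; comm = ⊕-comm
      }
    }
    where open import Relation.Binary.PropositionalEquality.Algebra using (isMagma)

  open AbelianGroup ℤmod using (_∙_; ε; _⁻¹; assoc; identityˡ; identityʳ; inverseˡ; inverseʳ; group)
  open AbelianGroupProperties ℤmod using (∙-cancelˡ; ∙-cancelʳ)

  private
    cancel-∙⁻¹ : ∀ x c → (x ∙ c) ∙ c ⁻¹ ≡ x
    cancel-∙⁻¹ x c = trans (assoc x c _) (trans (cong (x ∙_) (inverseʳ c)) (identityʳ x))

    cancel-⁻¹∙ : ∀ x c → (x ∙ c ⁻¹) ∙ c ≡ x
    cancel-⁻¹∙ x c = trans (assoc x _ c) (trans (cong (x ∙_) (inverseˡ c)) (identityʳ x))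

  -- The cycle (1 2 ⋯ n): position i + 1 of the word is the index i of
  -- Fin n, so ρ is i ↦ i + 1 mod n.
  ρ : Permutation′ n
  ρ = permutation (_∙ (1 mod n)) (_∙ (1 mod n) ⁻¹)
    (λ x → cancel-⁻¹∙ x _) (λ x → cancel-∙⁻¹ x _)

  ρ^_ : Fin n → Permutation′ n
  ρ^ i = power (Sym n) ρ (+ toℕ i)

  N⟨ρ⟩ : Pred (Permutation′ n) 0ℓ
  N⟨ρ⟩ = Normaliser (Sym n) (Generated (Sym n) ρ)

  private
    residue : ℤ → Fin n
    residue (+ k)    = k mod n
    residue -[1+ k ] = (suc k mod n) ⁻¹

    power-+ : ∀ k x → power (Sym n) ρ (+ k) ⟨$⟩ʳ x ≡ x ∙ (k mod n)
    power-+ ℕ.zero  x = sym (identityʳ x)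
    power-+ (suc k) x = trans (power-+ k (x ∙ (1 mod n)))
      (trans (assoc x _ _) (cong (x ∙_) (sym (mod-+ 1 k))))

    power-ρ : ∀ k x → power (Sym n) ρ k ⟨$⟩ʳ x ≡ x ∙ residue k
    power-ρ (+ k)    x = power-+ k x
    power-ρ -[1+ k ] x = trans (sym (cancel-∙⁻¹ _ _)) (cong (_∙ (suc k mod n) ⁻¹)
      (trans (sym (power-+ (suc k) _)) (Perm.inverseʳ (power (Sym n) ρ (+ suc k)))))

  ρ^-apply : ∀ i x → (ρ^ i) ⟨$⟩ʳ x ≡ x ∙ i
  ρ^-apply i x = trans (power-+ (toℕ i) x) (cong (x ∙_) (mod-toℕ i))

  φ-exists : ∀ (γ : Permutation′ n) → γ ∈ N⟨ρ⟩ → ∀ (i : Fin n) →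
             ∃! _≡_ λ (j : Fin n) → conjugate (Sym n) γ (ρ^ i) Perm.≈ ρ^ j
  φ-exists γ γ∈N i with proj₁ γ∈N {conjugate (Sym n) γ (ρ^ i)} (ρ^ i , (+ toℕ i , λ _ → refl) , λ _ → refl)
  ... | k , eq = residue k
      , (λ x → trans (eq x) (trans (power-ρ k x) (sym (ρ^-apply (residue k) x))))
      , λ {j} eq′ → ∙-cancelˡ ε _ _ (begin
          ε ∙ residue k                            ≡⟨ power-ρ k ε ⟨
          power (Sym n) ρ k ⟨$⟩ʳ ε                 ≡⟨ eq ε ⟨
          conjugate (Sym n) γ (ρ^ i) ⟨$⟩ʳ ε        ≡⟨ eq′ ε ⟩
          (ρ^ j) ⟨$⟩ʳ ε                            ≡⟨ ρ^-apply j ε ⟩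
          ε ∙ j                                    ∎)
    where open ≡-Reasoning

  φ-map : ∀ (γ : Permutation′ n) → γ ∈ N⟨ρ⟩ → Fin n → Fin n
  φ-map γ γ∈N i = proj₁ (φ-exists γ γ∈N i)

  private
    φ-apply : ∀ γ (γ∈N : γ ∈ N⟨ρ⟩) i x → γ ⟨$⟩ʳ ((γ ⟨$⟩ˡ x) ∙ i) ≡ x ∙ φ-map γ γ∈N i
    φ-apply γ γ∈N i x = trans (cong (γ ⟨$⟩ʳ_) (sym (ρ^-apply i _)))
      (trans (proj₁ (proj₂ (φ-exists γ γ∈N i)) x) (ρ^-apply _ x))

    φ-homo : ∀ γ (γ∈N : γ ∈ N⟨ρ⟩) i j →
             φ-map γ γ∈N (i ∙ j) ≡ φ-map γ γ∈N i ∙ φ-map γ γ∈N j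
    φ-homo γ γ∈N i j = ∙-cancelˡ ε _ _ (begin
      ε ∙ f (i ∙ j)                               ≡⟨ φ-apply γ γ∈N (i ∙ j) ε ⟨
      γ ⟨$⟩ʳ ((γ ⟨$⟩ˡ ε) ∙ (i ∙ j))               ≡⟨ cong (γ ⟨$⟩ʳ_) (assoc _ i j) ⟨
      γ ⟨$⟩ʳ (((γ ⟨$⟩ˡ ε) ∙ i) ∙ j)               ≡⟨ cong (λ z → γ ⟨$⟩ʳ (z ∙ j)) (Perm.inverseˡ γ) ⟨
      γ ⟨$⟩ʳ ((γ ⟨$⟩ˡ (γ ⟨$⟩ʳ ((γ ⟨$⟩ˡ ε) ∙ i))) ∙ j) ≡⟨ φ-apply γ γ∈N j _ ⟩
      (γ ⟨$⟩ʳ ((γ ⟨$⟩ˡ ε) ∙ i)) ∙ f j             ≡⟨ cong (_∙ f j) (φ-apply γ γ∈N i ε) ⟩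
      (ε ∙ f i) ∙ f j                             ≡⟨ assoc ε (f i) (f j) ⟩
      ε ∙ (f i ∙ f j)                             ∎)
      where
      open ≡-Reasoning
      f : Fin n → Fin n
      f = φ-map γ γ∈N

    φ-ε : ∀ γ (γ∈N : γ ∈ N⟨ρ⟩) → φ-map γ γ∈N ε ≡ ε
    φ-ε γ γ∈N = ∙-cancelˡ (f ε) _ _ (begin
      f ε ∙ f ε  ≡⟨ φ-homo γ γ∈N ε ε ⟨
      f (ε ∙ ε)  ≡⟨ cong f (identityʳ ε) ⟩
      f ε        ≡⟨ identityʳ (f ε) ⟨
      f ε ∙ ε    ∎)
      where
      open ≡-Reasoning
      f : Fin n → Fin n
      f = φ-map γ γ∈N

    φ-⁻¹ : ∀ γ (γ∈N : γ ∈ N⟨ρ⟩) i → φ-map γ γ∈N (i ⁻¹) ≡ φ-map γ γ∈N i ⁻¹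
    φ-⁻¹ γ γ∈N i = ∙-cancelʳ (f i) _ _ (begin
      f (i ⁻¹) ∙ f i  ≡⟨ φ-homo γ γ∈N (i ⁻¹) i ⟨
      f (i ⁻¹ ∙ i)    ≡⟨ cong f (inverseˡ i) ⟩
      f ε             ≡⟨ φ-ε γ γ∈N ⟩
      ε               ≡⟨ inverseˡ (f i) ⟨
      f i ⁻¹ ∙ f i    ∎)
      where
      open ≡-Reasoning
      f : Fin n → Fin n
      f = φ-map γ γ∈N

    φ-injective : ∀ γ (γ∈N : γ ∈ N⟨ρ⟩) → Injective _≡_ _≡_ (φ-map γ γ∈N)
    φ-injective γ γ∈N {i} {j} p = ∙-cancelˡ (γ ⟨$⟩ˡ ε) _ _ (begin
      (γ ⟨$⟩ˡ ε) ∙ i                       ≡⟨ Perm.inverseˡ γ ⟨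
      γ ⟨$⟩ˡ (γ ⟨$⟩ʳ ((γ ⟨$⟩ˡ ε) ∙ i))     ≡⟨ cong (γ ⟨$⟩ˡ_) (φ-apply γ γ∈N i ε) ⟩
      γ ⟨$⟩ˡ (ε ∙ φ-map γ γ∈N i)           ≡⟨ cong (λ z → γ ⟨$⟩ˡ (ε ∙ z)) p ⟩
      γ ⟨$⟩ˡ (ε ∙ φ-map γ γ∈N j)           ≡⟨ cong (γ ⟨$⟩ˡ_) (φ-apply γ γ∈N j ε) ⟨
      γ ⟨$⟩ˡ (γ ⟨$⟩ʳ ((γ ⟨$⟩ˡ ε) ∙ j))     ≡⟨ Perm.inverseˡ γ ⟩
      (γ ⟨$⟩ˡ ε) ∙ j                       ∎)
      where open ≡-Reasoning

    φ-surjective : ∀ γ (γ∈N : γ ∈ N⟨ρ⟩) → Surjective _≡_ _≡_ (φ-map γ γ∈N)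
    φ-surjective γ γ∈N j with proj₂ γ∈N {ρ^ j} (+ toℕ j , λ _ → refl)
    ... | h , (k , h≈ρᵏ) , ρʲ≈ = residue k , λ { refl → ∙-cancelˡ ε _ _ (begin
      ε ∙ φ-map γ γ∈N (residue k)               ≡⟨ φ-apply γ γ∈N (residue k) ε ⟨
      γ ⟨$⟩ʳ ((γ ⟨$⟩ˡ ε) ∙ residue k)           ≡⟨ cong (γ ⟨$⟩ʳ_) (power-ρ k _) ⟨
      γ ⟨$⟩ʳ (power (Sym n) ρ k ⟨$⟩ʳ (γ ⟨$⟩ˡ ε)) ≡⟨ cong (γ ⟨$⟩ʳ_) (h≈ρᵏ _) ⟨
      γ ⟨$⟩ʳ (h ⟨$⟩ʳ (γ ⟨$⟩ˡ ε))                ≡⟨ ρʲ≈ ε ⟨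
      (ρ^ j) ⟨$⟩ʳ ε                             ≡⟨ ρ^-apply j ε ⟩
      ε ∙ j                                     ∎) }
      where open ≡-Reasoning

  φ : ∀ (γ : Permutation′ n) → γ ∈ N⟨ρ⟩ → Automorphism group
  φ γ γ∈N = record
    { ⟦_⟧ = φ-map γ γ∈N
    ; isGroupIsomorphism = record
      { isGroupMonomorphism = record
        { isGroupHomomorphism = record
          { isMonoidHomomorphism = record
            { isMagmaHomomorphism = record
              { isRelHomomorphism = record { cong = cong (φ-map γ γ∈N) }
              ; homo = φ-homo γ γ∈N
              }
            ; ε-homo = φ-ε γ γ∈N
            }
          ; ⁻¹-homo = φ-⁻¹ γ γ∈N
          }
        ; injective = φ-injective γ γ∈N
        }
      ; surjective = φ-surjective γ γ∈N
      }
    }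

-- A set of M words, presented by an injective enumeration; the alphabet
-- of size q is Fin q.
record FHS (n M q : ℕ) : Set where
  field
    word     : Fin M → Vec (Fin q) n
    distinct : Injective _≡_ _≡_ word

-- The entry of w in position i becomes the entry in position i^γ, so
-- position j receives the entry from j^(γ⁻¹).
permuteWord : ∀ {A : Set} {n} → Permutation′ n → Vec A n → Vec A n
permuteWord γ w = tabulate λ j → lookup w (γ ⟨$⟩ˡ j)

permuteWord-lookup : ∀ {A : Set} {n} (γ : Permutation′ n) (w : Vec A n) i →
                     lookup (permuteWord γ w) (γ ⟨$⟩ʳ i) ≡ lookup w i
permuteWord-lookup γ w i =
  trans (lookup∘tabulate _ (γ ⟨$⟩ʳ i)) (cong (lookup w) (Perm.inverseˡ γ))

permuteWord-injective : ∀ {A : Set} {n} (γ : Permutation′ n) →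
                        Injective _≡_ _≡_ (permuteWord {A} γ)
permuteWord-injective γ {v} {w} p = begin
  v                    ≡⟨ tabulate∘lookup v ⟨
  tabulate (lookup v)  ≡⟨ tabulate-cong (λ i → trans (sym (permuteWord-lookup γ v i))
                            (trans (cong (λ u → lookup u (γ ⟨$⟩ʳ i)) p) (permuteWord-lookup γ w i))) ⟩
  tabulate (lookup w)  ≡⟨ tabulate∘lookup w ⟩
  w                    ∎
  where open ≡-Reasoning

permuteFHS : ∀ {n M q} → Permutation′ n → FHS n M q → FHS n M q
permuteFHS γ F = record
  { word     = λ m → permuteWord γ (FHS.word F m)
  ; distinct = λ p → FHS.distinct F (permuteWord-injective γ p)
  }

-- The members of the family may be empty: a symbol need not occur in
-- a word.
record PartitionDDF (n q : ℕ) : Set₁ where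
  field
    Q        : Fin q → Pred (Fin n) 0ℓ
    disjoint : ∀ {f g} → f ≢ g → Q f ⊥ Q g
    covers   : ∀ x → ∃ λ f → x ∈ Q f

infix 4 _≈ᴰ_
_≈ᴰ_ : ∀ {n q} → PartitionDDF n q → PartitionDDF n q → Set
D ≈ᴰ E = ∀ f → PartitionDDF.Q D f ≐ PartitionDDF.Q E f

correspondingDDF : ∀ {n q} → FHS n 1 q → PartitionDDF n q
correspondingDDF F = record
  { Q        = λ f j → lookup (FHS.word F zero) j ≡ f
  ; disjoint = λ f≢g (p , q) → f≢g (trans (sym p) q)
  ; covers   = λ j → lookup (FHS.word F zero) j , refl
  }

image : ∀ {n} → (Fin n → Fin n) → Pred (Fin n) 0ℓ → Pred (Fin n) 0ℓ
image f P y = ∃ λ x → x ∈ P × y ≡ f x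

imageDDF : ∀ {n q} (f : Fin n → Fin n) → Bijective _≡_ _≡_ f →
           PartitionDDF n q → PartitionDDF n q
imageDDF f (inj , surj) D = record
  { Q        = λ s → image f (PartitionDDF.Q D s)
  ; disjoint = λ { s≢t ((x , x∈ , refl) , (y , y∈ , p)) →
      PartitionDDF.disjoint D s≢t
        (x∈ , subst (PartitionDDF.Q D _) (sym (inj p)) y∈) }
  ; covers   = λ y →
      let x , fx≡y = surj y
          s , x∈   = PartitionDDF.covers D x
      in s , x , x∈ , sym (fx≡y refl)
  }

module _ {n : ℕ} .{{_ : NonZero n}} {q : ℕ} where
  open AbelianGroup (ℤmod n)
    using (_∙_; _⁻¹; group; assoc; inverseˡ; identityʳ)
  open AbelianGroupProperties (ℤmod n) using (∙-cancelʳ)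

  applyAutomorphism : Automorphism group → PartitionDDF n q → PartitionDDF n q
  applyAutomorphism α = imageDDF ⟦_⟧ (injective , surjective)
    where open Automorphism α

  translate : Fin n → PartitionDDF n q → PartitionDDF n q
  translate c = imageDDF (_∙ c)
    ( ∙-cancelʳ c _ _
    , λ y → y ∙ c ⁻¹ , λ { refl →
        trans (assoc y _ c) (trans (cong (y ∙_) (inverseˡ c)) (identityʳ y)) })

  infix 4 _IsTranslationOf_
  _IsTranslationOf_ : PartitionDDF n q → PartitionDDF n q → Set
  E IsTranslationOf D = ∃ λ (c : Fin n) → E ≈ᴰ translate c D

{-# OPTIONS --safe #-}
module Submission where

open import Data.Nat.Base using (ℕ; NonZero)
open import Data.Fin.Permutation using (Permutation′)
open import Relation.Unary using (_∈_)
open import Defs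
open import Algebra.Bundles using (AbelianGroup)
open import Data.Fin.Base using (Fin; zero)
open import Data.Fin.Permutation using (_⟨$⟩ʳ_; _⟨$⟩ˡ_; inverseˡ; inverseʳ)
open import Data.Product using (_,_; proj₁; proj₂)
open import Data.Vec.Base using (lookup)
open import Data.Vec.Properties using (lookup∘tabulate)
open import Relation.Binary.PropositionalEquality

-- Evaluating γ⁻¹ρⁱγ = ρ^φ(i) at the point 0^γ shows that γ is the affine map
-- i ↦ φ(i) + 0^γ on ℤ_n, so the translation is by c = 0^γ.

-- The symbol at index `x` moves to the index `x^γ`, which by `normaliser-affine` is `φ(x) + c` with
-- `c = 0^γ`. So the index set of each symbol `f` goes from `Q f` to `φ(Q f) + c`, and `c` does not
-- depend on `f`: one translation serves the whole family.

module _ (n : ℕ) .{{_ : NonZero n}} where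
  open AbelianGroup (ℤmod n) using (_∙_; ε; identityˡ; comm)

  normaliser-affine : ∀ (γ : Permutation′ n) (γ∈N : γ ∈ N⟨ρ⟩ n) i →
                      γ ⟨$⟩ʳ i ≡ φ-map n γ γ∈N i ∙ (γ ⟨$⟩ʳ ε)
  normaliser-affine γ γ∈N i = begin
    γ ⟨$⟩ʳ i                                      ≡⟨ cong (γ ⟨$⟩ʳ_) (identityˡ i) ⟨
    γ ⟨$⟩ʳ (ε ∙ i)                                ≡⟨ cong (γ ⟨$⟩ʳ_) (ρ^-apply n i ε) ⟨
    -- Writing `0` as `(0^γ)^(γ⁻¹)` turns the term, by definition, into the conjugate of `ρ^ i`
    -- evaluated at `0^γ`, where the defining property of `φ` applies.
    γ ⟨$⟩ʳ (ρ^_ n i ⟨$⟩ʳ ε)                       ≡⟨ cong (λ x → γ ⟨$⟩ʳ (ρ^_ n i ⟨$⟩ʳ x)) (inverseˡ γ) ⟨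
    γ ⟨$⟩ʳ (ρ^_ n i ⟨$⟩ʳ (γ ⟨$⟩ˡ (γ ⟨$⟩ʳ ε)))     ≡⟨ proj₁ (proj₂ (φ-exists n γ γ∈N i)) (γ ⟨$⟩ʳ ε) ⟩
    ρ^_ n (φ-map n γ γ∈N i) ⟨$⟩ʳ (γ ⟨$⟩ʳ ε)       ≡⟨ ρ^-apply n (φ-map n γ γ∈N i) (γ ⟨$⟩ʳ ε) ⟩
    (γ ⟨$⟩ʳ ε) ∙ φ-map n γ γ∈N i                  ≡⟨ comm (γ ⟨$⟩ʳ ε) (φ-map n γ γ∈N i) ⟩
    φ-map n γ γ∈N i ∙ (γ ⟨$⟩ʳ ε)                  ∎
    where open ≡-Reasoning

theorem5p12 : ∀ (n q : ℕ) .{{_ : NonZero n}} (F : FHS n 1 q)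
    (γ : Permutation′ n) (γ∈N : γ ∈ N⟨ρ⟩ n) →
    correspondingDDF (permuteFHS γ F)
    IsTranslationOf applyAutomorphism (φ n γ γ∈N) (correspondingDDF F)
theorem5p12 n q F γ γ∈N = γ ⟨$⟩ʳ ε , λ f →
    -- The entry now at `y` came from `γ ⟨$⟩ˡ y`, so that index is the witness in the old set.
    (λ {y} y∈ → φ-map n γ γ∈N (γ ⟨$⟩ˡ y)
      , (γ ⟨$⟩ˡ y , trans (sym (lookup∘tabulate _ y)) y∈ , refl)
      , trans (sym (inverseʳ γ)) (normaliser-affine n γ γ∈N (γ ⟨$⟩ˡ y)))
  -- Conversely, the point has the form `φ(x) + c`; read as `γ ⟨$⟩ʳ x`, it carries the old entry at
  -- `x`.
  , λ { (_ , (x , x∈ , refl) , refl) →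
      trans (cong (lookup (permuteWord γ w)) (sym (normaliser-affine n γ γ∈N x)))
        (trans (permuteWord-lookup γ w x) x∈) }
  where
  open AbelianGroup (ℤmod n) using (ε)
  w = FHS.word F zero
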